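{- The generating function $$F_{(231,312)}(x,p,q,u,v,s,t)=\sum_{n\ge0}\ \sum_{\pi\in S_n(231,312)} x^n p^{\operatorname{asc}(\pi)}q^{\operatorname{des}(\pi)}u^{\operatorname{lrmax}(\pi)}v^{\operatorname{rlmax}(\pi)}s^{\operatorname{lrmin}(\pi)}t^{\operatorname{rlmin}(\pi)}$$ is equal to $\dfrac{A}{(1-qsx)(1-qx-ptux)(1-qvx)(1-qsvx)}$, where $$\begin{aligned}A={}&1 - p t u x + s t u v x + q^4 s^2 v^2 x^4 + q^3 s v x^3 \bigl(-1 - v + s (-1 + v (-1 + (-1 + p) t u x))\bigr)\\ &- q x \bigl(1 + v - p t u v x + s^2 t u v x (1 + p t u (-1 + v) x) + s (1 + v - p t u x - (-1 + p) t u v x + p t^2 u^2 v x^2 + t u v^2 x (1 - p t u x))\bigr)\\ &+ q^2 x^2 \bigl(v + s^2 v (1 + t u (1 - p + v) x) + s (1 + v^2 (1 - (-1 + p) t u x) + v (2 - p t u x))\bigr).\end{aligned}$$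
   Context: For $n\ge 0$, $S_n$ denotes the set of permutations $\pi=\pi_1\cdots\pi_n$ of $[n]=\{1,\dots,n\}$ ($S_0$ consists of the empty permutation, for which all statistics are $0$). $\pi$ avoids a pattern $\tau\in S_k$ if no subsequence $\pi_{i_1}\cdots\pi_{i_k}$ ($i_1<\dots<i_k$) satisfies $\pi_{i_a}<\pi_{i_b}\iff\tau_a<\tau_b$; $S_n(\tau,\rho)$ is the set of permutations in $S_n$ avoiding both $\tau$ and $\rho$. $\operatorname{asc}(\pi)$ (resp. $\operatorname{des}(\pi)$) is the number of $i\in[n-1]$ with $\pi_i<\pi_{i+1}$ (resp. $\pi_i>\pi_{i+1}$). $\pi_i$ is a left-to-right maximum (resp. minimum) if it is larger (resp. smaller) than every $\pi_j$ with $j<i$, and a right-to-left maximum (resp. minimum) if it is larger (resp. smaller) than every $\pi_j$ with $j>i$; $\operatorname{lrmax},\operatorname{lrmin},\operatorname{rlmax},\operatorname{rlmin}$ count these. -}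

module Defs where

open import Algebra.Bundles using (CommutativeRing; RawRing)
import Algebra.Definitions.RawSemiring as RawSemiringDefs
import Algebra.Properties.AbelianGroup as AbelianGroupProperties
import Algebra.Properties.Semiring.Exp as Exp
import Algebra.Properties.Semiring.Sum as Sum
open import Data.Fin.Base using (Fin; zero; suc; toℕ; inject₁; _<_)
open import Data.Fin.Properties using (_≟_; _<?_; any?; all?)
open import Data.Fin.Patterns using (0F; 1F; 2F)
open import Data.List.Base as List using (List; cartesianProductWith; filter)
open import Data.Nat.Base as ℕ using (ℕ; zero; suc)
open import Data.Product.Base using (∃; _×_; _,_; uncurry)
open import Data.Vec.Base using (Vec; []; _∷_; lookup; allFin; count)
open import Data.Vec.Relation.Unary.AllPairs using (AllPairs; allPairs?)
open import Data.Vec.Relation.Unary.Unique.Propositional using (Unique)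
open import Function.Bundles using (_⇔_; mk⇔; Equivalence)
open import Level using (Level)
import Relation.Binary.Reasoning.Setoid as SetoidReasoning
open import Relation.Nullary.Decidable
  using (Dec; ¬?; _×-dec_; _→-dec_; map′)
open import Relation.Nullary.Negation using (¬_)
open import Relation.Unary using (Pred; Decidable)

private
  variable
    a c ℓ : Level
    k n : ℕ

------------------------------------------------------------------------
-- Permutations and patterns

-- A permutation of [n] is a word of length n over Fin n with distinct
-- letters (one-line notation, with letters and positions numbered from 0).

words : ∀ n k → List (Vec (Fin n) k)
words n zero    = List.[ [] ]
words n (suc k) = cartesianProductWith _∷_ (List.allFin n) (words n k)

IsPermutation : Vec (Fin n) n → Set
IsPermutation = Unique

isPermutation? : Decidable (IsPermutation {n})
isPermutation? = allPairs? λ i j → ¬? (i ≟ j)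

permutations : ∀ n → List (Vec (Fin n) n)
permutations n = filter isPermutation? (words n n)

_⇔-dec_ : {A B : Set} → Dec A → Dec B → Dec (A ⇔ B)
A? ⇔-dec B? = map′ (uncurry mk⇔) (λ e → Equivalence.to e , Equivalence.from e)
                   ((A? →-dec B?) ×-dec (B? →-dec A?))

anyVec? : ∀ k {P : Pred (Vec (Fin n) k) a} → Decidable P → Dec (∃ P)
anyVec? zero    P? = map′ ([] ,_) (λ { ([] , p) → p }) (P? [])
anyVec? (suc k) P? = map′ (λ { (i , is , p) → i ∷ is , p })
                          (λ { (i ∷ is , p) → i , is , p })
                          (any? λ i → anyVec? k λ is → P? (i ∷ is))

-- For a vector of positions, AllPairs _<_ says that i₁ < ⋯ < iₖ.

IsOccurrence : Vec (Fin k) k → Vec (Fin n) n → Vec (Fin n) k → Set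
IsOccurrence τ π i =
  AllPairs _<_ i ×
  (∀ a b → lookup π (lookup i a) < lookup π (lookup i b) ⇔
           lookup τ a < lookup τ b)

isOccurrence? : (τ : Vec (Fin k) k) (π : Vec (Fin n) n) →
                Decidable (IsOccurrence τ π)
isOccurrence? τ π i =
  allPairs? _<?_ i ×-dec
  all? λ a → all? λ b →
    (lookup π (lookup i a) <? lookup π (lookup i b)) ⇔-dec
    (lookup τ a <? lookup τ b)

_Avoids_ : Vec (Fin n) n → Vec (Fin k) k → Set
π Avoids τ = ¬ ∃ (IsOccurrence τ π)

_avoids?_ : (π : Vec (Fin n) n) (τ : Vec (Fin k) k) → Dec (π Avoids τ)
_avoids?_ {k = k} π τ = ¬? (anyVec? k (isOccurrence? τ π))

S : ∀ n {j k} → Vec (Fin j) j → Vec (Fin k) k → List (Vec (Fin n) n)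
S n τ ρ = filter (λ π → (π avoids? τ) ×-dec (π avoids? ρ)) (permutations n)

[231] [312] : Vec (Fin 3) 3
[231] = 1F ∷ 2F ∷ 0F ∷ []
[312] = 2F ∷ 0F ∷ 1F ∷ []

------------------------------------------------------------------------
-- Statistics

asc des lrmax lrmin rlmax rlmin : Vec (Fin n) n → ℕ

asc {zero}  π = 0
asc {suc n} π =
  count (λ i → lookup π (inject₁ i) <? lookup π (suc i)) (allFin n)

des {zero}  π = 0
des {suc n} π =
  count (λ i → lookup π (suc i) <? lookup π (inject₁ i)) (allFin n)

lrmax {n} π =
  count (λ i → all? λ j → (j <? i) →-dec (lookup π j <? lookup π i)) (allFin n)

lrmin {n} π =
  count (λ i → all? λ j → (j <? i) →-dec (lookup π i <? lookup π j)) (allFin n)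

rlmax {n} π =
  count (λ i → all? λ j → (i <? j) →-dec (lookup π j <? lookup π i)) (allFin n)

rlmin {n} π =
  count (λ i → all? λ j → (i <? j) →-dec (lookup π i <? lookup π j)) (allFin n)

------------------------------------------------------------------------
-- Formal power series in one variable, as coefficient sequences

module PowerSeries (R : CommutativeRing c ℓ) where
  private
    module R where
      open CommutativeRing R public
      open Sum semiring public using (sum)

  Series : Set c
  Series = ℕ → R.Carrier

  C : R.Carrier → Series
  C r zero    = r
  C r (suc _) = R.0#

  X : Series
  X 1 = R.1#
  X _ = R.0#

  rawRing : RawRing c ℓ
  rawRing = record
    { Carrier = Series
    ; _≈_     = λ f g → ∀ n → f n R.≈ g n
    ; _+_     = λ f g n → f n R.+ g n
    ; _*_     = λ f g n → R.sum {suc n} λ i → f (toℕ i) R.* g (n ℕ.∸ toℕ i)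
    ; -_      = λ f n → R.- f n
    ; 0#      = C R.0#
    ; 1#      = C R.1#
    }

  open RawRing rawRing public
    using (_≈_; _+_; _*_; -_; 0#; 1#; rawSemiring)
  open RawSemiringDefs rawSemiring public using (_^_)

  infixl 6 _-_
  _-_ : Series → Series → Series
  f - g = f + - g

  -- Long division, for a divisor g with constant term 1: the quotient has
  -- constant term f 0, and its tail is ((f - f 0 · g) / X) / g.

  infixl 7 _/_
  _/_ : Series → Series → Series
  (f / g) zero    = f 0
  (f / g) (suc n) = ((λ k → f (suc k) R.- f 0 R.* g (suc k)) / g) n

  /-*-cancel : ∀ f g → g 0 R.≈ R.1# → (f / g) * g ≈ f
  /-*-cancel f g g₀≈1 zero = begin
    f 0 R.* g 0 R.+ R.0#  ≈⟨ R.+-identityʳ _ ⟩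
    f 0 R.* g 0           ≈⟨ R.*-congˡ g₀≈1 ⟩
    f 0 R.* R.1#          ≈⟨ R.*-identityʳ _ ⟩
    f 0                   ∎
    where open SetoidReasoning R.setoid
  /-*-cancel f g g₀≈1 (suc n) = begin
    fg R.+ ((λ k → f (suc k) R.- f 0 R.* g (suc k)) / g * g) n
      ≈⟨ R.+-congˡ (/-*-cancel (λ k → f (suc k) R.- f 0 R.* g (suc k)) g g₀≈1 n) ⟩
    fg R.+ (f (suc n) R.- fg)
      ≈⟨ R.+-assoc _ _ _ ⟨
    fg R.+ f (suc n) R.- fg
      ≈⟨ xyx⁻¹≈y fg (f (suc n)) ⟩
    f (suc n) ∎
    where
    open SetoidReasoning R.setoid
    open AbelianGroupProperties R.+-abelianGroup using (xyx⁻¹≈y)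
    fg = f 0 R.* g (suc n)

------------------------------------------------------------------------
-- The generating function, as a power series in x whose coefficients are
-- evaluated at p, q, u, v, s, t in an arbitrary commutative ring R (taking
-- R = ℤ[p,q,u,v,s,t] makes them independent indeterminates)

module GeneratingFunction (R : CommutativeRing c ℓ) where
  open CommutativeRing R using (Carrier; _+_; _*_; 0#; semiring)
  open Exp semiring using (_^_)
  open PowerSeries R using (Series)

  weight : (p q u v s t : Carrier) → Vec (Fin n) n → Carrier
  weight p q u v s t π =
    p ^ asc π * q ^ des π * u ^ lrmax π * v ^ rlmax π * s ^ lrmin π * t ^ rlmin π

  F : ∀ {j k} → Vec (Fin j) j × Vec (Fin k) k →
      (p q u v s t : Carrier) → Series
  F (τ , ρ) p q u v s t n =
    List.foldr _+_ 0# (List.map (weight p q u v s t) (S n τ ρ))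

module _ (R : CommutativeRing c ℓ) where
  open PowerSeries R

  A : (x p q u v s t : Series) → Series
  A x p q u v s t =
    1# - p * t * u * x + s * t * u * v * x + q ^ 4 * s ^ 2 * v ^ 2 * x ^ 4
    + q ^ 3 * s * v * x ^ 3
      * (- 1# - v + s * (- 1# + v * (- 1# + (- 1# + p) * t * u * x)))
    - q * x
      * (1# + v - p * t * u * v * x
         + s ^ 2 * t * u * v * x * (1# + p * t * u * (- 1# + v) * x)
         + s * (1# + v - p * t * u * x - (- 1# + p) * t * u * v * x
                + p * t ^ 2 * u ^ 2 * v * x ^ 2
                + t * u * v ^ 2 * x * (1# - p * t * u * x)))
    + q ^ 2 * x ^ 2
      * (v + s ^ 2 * v * (1# + t * u * (1# - p + v) * x)
         + s * (1# + v ^ 2 * (1# - (- 1# + p) * t * u * x)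
                + v * (1# + 1# - p * t * u * x)))

{-# OPTIONS --safe #-}

-- The permutations avoiding 231 and 312 are the layered ones: direct sums of
-- decreasing blocks.  For n ≥ 1, such a permutation of [n + 1] arises from one
-- of [n] in exactly two ways: either a new block of size 1 is put in front, or
-- the first block grows by one.  Both steps act on the weight by a monomial,
-- except that the first one resets lrmin to 1 (whence s = 1 on the right-hand
-- side of the recurrence) and the second one changes rlmax exactly when there is
-- a single block.  So the decreasing permutation of [n + 1] (weight δ s n) is
-- split off from the other layered ones (total weight μ s n), which gives
--   δ s (n + 1) = q v s δ s n,
--   μ s (n + 1) = p u t s (δ 1 n + μ 1 n) + q s μ s n,
-- a linear system for the generating functions.

module Submission where

open import Algebra.Bundles using (CommutativeRing)
import Algebra.Properties.AbelianGroup as AbelianGroupProperties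
import Algebra.Properties.CommutativeSemigroup as CommutativeSemigroupProperties
import Algebra.Properties.Ring as RingProperties
import Algebra.Properties.Semiring.Exp as Exp
import Algebra.Properties.Semiring.Mult.TCOptimised as Mult
import Algebra.Solver.Ring as RingSolver
open import Algebra.Solver.Ring.AlmostCommutativeRing
  using (fromCommutativeRing; _-Raw-AlmostCommutative⟶_)
open import Data.Empty using (⊥-elim)
open import Data.Fin.Base
  using (Fin; zero; suc; toℕ; fromℕ<; inject₁; punchIn; punchOut; _<_; _≤_)
open import Data.Fin.Patterns
import Data.Fin.Properties as Fin
open import Data.Fin.Properties using (_≟_; _<?_; all?; any?)
open import Data.Integer.Base as ℤ using (ℤ; +_; +0; +[1+_]; -[1+_])
import Data.Integer.Properties as ℤ
open import Data.List.Base as List using (List; _++_)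
open import Data.List.Membership.Propositional using (_∈_)
open import Data.List.Membership.Propositional.Properties
  using (∈-map⁺; ∈-map⁻; ∈-++⁺ˡ; ∈-++⁺ʳ; ∈-filter⁺; ∈-filter⁻; ∈-cartesianProductWith⁺; ∈-allFin)
open import Data.List.Membership.Propositional.Properties.WithK using (unique∧set⇒bag)
open import Data.List.Relation.Binary.BagAndSetEquality using (∼bag⇒↭)
open import Data.List.Relation.Binary.Permutation.Propositional using (_↭_; ↭⇒↭ₛ)
import Data.List.Relation.Binary.Permutation.Setoid.Properties as SetoidPermutation
open import Data.List.Relation.Unary.All as ListAll using ([]; _∷_)
import Data.List.Relation.Unary.All.Properties as ListAll
open import Data.List.Relation.Unary.AllPairs using ([]; _∷_)
open import Data.List.Relation.Unary.Any using (here; there)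
import Data.List.Relation.Unary.Unique.Propositional as ListUnique
import Data.List.Relation.Unary.Unique.Propositional.Properties as ListUnique
import Data.Maybe.Base as Maybe
open import Data.Nat.Base as ℕ using (ℕ; zero; suc; z≤n; s≤s)
import Data.Nat.Properties as ℕ
open import Data.Product.Base using (∃; _×_; _,_; proj₂)
open import Data.Vec.Base using (Vec; []; _∷_; lookup; map; tabulate; count)
open import Data.Vec.Properties using (∷-injective; lookup-map)
open import Data.Vec.Relation.Unary.All as All using (All; []; _∷_)
import Data.Vec.Relation.Unary.All.Properties as All
open import Data.Vec.Relation.Unary.AllPairs using (AllPairs; []; _∷_)
open import Data.Vec.Relation.Unary.Unique.Propositional using (Unique)
import Data.Vec.Relation.Unary.Unique.Propositional.Properties as Unique
open import Function.Base using (_∘_; id)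
open import Function.Bundles using (_⇔_; mk⇔; Equivalence)
open import Level using (Level)
open import Relation.Binary.Consequences using (dec⇒weaklyDec)
open import Relation.Binary.Definitions using (tri<; tri≈; tri>)
open import Relation.Binary.PropositionalEquality as ≡ using (_≡_; _≢_)
import Relation.Binary.Reasoning.Setoid as SetoidReasoning
open import Relation.Nullary.Decidable using (yes; no; _×-dec_; _→-dec_)
open import Relation.Nullary.Negation using (¬_; contradiction)
open import Relation.Unary using (Pred; Decidable)

open import Defs

open Equivalence using (to; from)

private
  variable
    a b c ℓ p q : Level
    T U : Set a
    k m n : ℕ

-- Counting positions with a property

module _ {P : Pred T p} (P? : Decidable P) where

  -- The function `f` is arbitrary so that the first position can be peeled off and the count
  -- continued with `f ∘ suc`; `allFin n` is the case `f = id`.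
  count-accept : (f : Fin (suc n) → T) → P (f zero) →
                 count P? (tabulate f) ≡ suc (count P? (tabulate (f ∘ suc)))
  count-accept f p₀ with P? (f zero)
  ... | yes _  = ≡.refl
  ... | no ¬p₀ = contradiction p₀ ¬p₀

  count-reject : (f : Fin (suc n) → T) → ¬ P (f zero) →
                 count P? (tabulate f) ≡ count P? (tabulate (f ∘ suc))
  count-reject f ¬p₀ with P? (f zero)
  ... | yes p₀ = contradiction p₀ ¬p₀
  ... | no _   = ≡.refl

  count-none : (f : Fin n → T) → (∀ i → ¬ P (f i)) → count P? (tabulate f) ≡ 0
  count-none {zero}  f ¬p = ≡.refl
  count-none {suc n} f ¬p = ≡.trans (count-reject f (¬p zero)) (count-none (f ∘ suc) (¬p ∘ suc))

  module _ {Q : Pred U q} (Q? : Decidable Q) where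

    -- Two different index types are allowed because positions of a permutation are compared with
    -- positions of a longer one, typically with `f = suc` and `g = id`.
    count-cong : (f : Fin n → T) (g : Fin n → U) → (∀ i → P (f i) ⇔ Q (g i)) →
                 count P? (tabulate f) ≡ count Q? (tabulate g)
    count-cong {zero}  f g eq = ≡.refl
    count-cong {suc n} f g eq with Q? (g zero)
    ... | yes q₀ = ≡.trans (count-accept f (from (eq zero) q₀))
                         (≡.cong suc (count-cong (f ∘ suc) (g ∘ suc) (eq ∘ suc)))
    ... | no ¬q₀ = ≡.trans (count-reject f (¬q₀ ∘ to (eq zero)))
                         (count-cong (f ∘ suc) (g ∘ suc) (eq ∘ suc))

-- Decision procedures behind the statistics

module _ (π : Vec (Fin (suc n)) (suc n)) where

  -- These procedures repeat those in the definitions of the statistics, so that each statistic is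
  -- definitionally a `count` to which the counting lemmas apply.
  asc? : Decidable λ i → lookup π (inject₁ i) < lookup π (suc i)
  asc? i = lookup π (inject₁ i) <? lookup π (suc i)

  des? : Decidable λ i → lookup π (suc i) < lookup π (inject₁ i)
  des? i = lookup π (suc i) <? lookup π (inject₁ i)

module _ (π : Vec (Fin n) n) where

  lrmax? : Decidable λ i → ∀ j → j < i → lookup π j < lookup π i
  lrmax? i = all? λ j → (j <? i) →-dec (lookup π j <? lookup π i)

  lrmin? : Decidable λ i → ∀ j → j < i → lookup π i < lookup π j
  lrmin? i = all? λ j → (j <? i) →-dec (lookup π i <? lookup π j)

  rlmax? : Decidable λ i → ∀ j → i < j → lookup π j < lookup π i
  rlmax? i = all? λ j → (i <? j) →-dec (lookup π j <? lookup π i)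

  rlmin? : Decidable λ i → ∀ j → i < j → lookup π i < lookup π j
  rlmin? i = all? λ j → (i <? j) →-dec (lookup π i <? lookup π j)

-- Relabelling by `punchIn` and the order

punchIn-mono-< : ∀ i (j k : Fin n) → j < k → punchIn i j < punchIn i k
punchIn-mono-< i j k j<k = ℕ.≰⇒> (ℕ.<⇒≱ j<k ∘ Fin.punchIn-cancel-≤ i k j)

punchIn-cancel-< : ∀ i (j k : Fin n) → punchIn i j < punchIn i k → j < k
punchIn-cancel-< i j k ↑j<↑k = ℕ.≰⇒> (ℕ.<⇒≱ ↑j<↑k ∘ Fin.punchIn-mono-≤ i k j)

punchIn-below : {i : Fin (suc n)} {j : Fin n} → j < i → punchIn i j < i
punchIn-below {i = suc i} {zero}  _         = s≤s z≤n
punchIn-below {i = suc i} {suc j} (s≤s j<i) = s≤s (punchIn-below j<i)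

punchIn-above : {i : Fin (suc n)} {j : Fin n} → i ≤ j → i < punchIn i j
punchIn-above {i = zero}          _         = s≤s z≤n
punchIn-above {i = suc i} {suc j} (s≤s i≤j) = s≤s (punchIn-above i≤j)

-- Prepending a letter

-- `punchIn h` raises the letters from `h` on by one: this frees the letter `h` and keeps the
-- relative order of the others.
prepend : Fin (suc n) → Vec (Fin n) n → Vec (Fin (suc n)) (suc n)
prepend h π = h ∷ map (punchIn h) π

1⊕_ : Vec (Fin n) n → Vec (Fin (suc n)) (suc n)
1⊕ π = prepend zero π

-- For a layered π, the first block grows by one.
enlarge : Vec (Fin (suc n)) (suc n) → Vec (Fin (suc (suc n))) (suc (suc n))
enlarge π = prepend (suc (lookup π zero)) π

decreasing : ∀ n → Vec (Fin (suc n)) (suc n)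
decreasing zero    = zero ∷ []
decreasing (suc n) = enlarge (decreasing n)

-- The layered permutations with at least two blocks. If the first block has size 1, any layered
-- permutation may follow; otherwise shrinking it leaves at least two blocks.
multilayered : ∀ n → List (Vec (Fin (suc n)) (suc n))
multilayered zero    = List.[]
multilayered (suc n) =
  List.map 1⊕_ (decreasing n List.∷ multilayered n) ++ List.map enlarge (multilayered n)

module _ (h : Fin (suc n)) (π : Vec (Fin n) n) where

  tail-< : ∀ i j →
           lookup (prepend h π) (suc i) < lookup (prepend h π) (suc j) ⇔ lookup π i < lookup π j
  tail-< i j rewrite lookup-map i (punchIn h) π | lookup-map j (punchIn h) π =
    mk⇔ (punchIn-cancel-< h _ _) (punchIn-mono-< h _ _)

  -- A letter of `π` equal to `h` is moved above `h`; hence the strict inequality here and the weak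
  -- one in `h<tail`.
  tail<h : ∀ i → lookup (prepend h π) (suc i) < h ⇔ lookup π i < h
  tail<h i rewrite lookup-map i (punchIn h) π with lookup π i <? h
  ... | yes x<h = mk⇔ (λ _ → x<h) (λ _ → punchIn-below x<h)
  ... | no  x≮h = mk⇔ (λ ↑x<h → contradiction ↑x<h (ℕ.<⇒≯ (punchIn-above (ℕ.≮⇒≥ x≮h))))
                      (λ x<h → contradiction x<h x≮h)

  h<tail : ∀ i → h < lookup (prepend h π) (suc i) ⇔ h ≤ lookup π i
  h<tail i rewrite lookup-map i (punchIn h) π with lookup π i <? h
  ... | yes x<h = mk⇔ (λ h<↑x → contradiction h<↑x (ℕ.<⇒≯ (punchIn-below x<h)))
                      (λ h≤x → contradiction x<h (ℕ.≤⇒≯ h≤x))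
  ... | no  x≮h = mk⇔ (λ _ → ℕ.≮⇒≥ x≮h) punchIn-above

-- Effect of the two growth steps on the statistics

module _ (π : Vec (Fin (suc n)) (suc n)) where

  0<tail : ∀ i → lookup (1⊕ π) zero < lookup (1⊕ π) (suc i)
  0<tail i = from (h<tail zero π i) z≤n

  asc-1⊕ : asc (1⊕ π) ≡ suc (asc π)
  asc-1⊕ = ≡.trans (count-accept (asc? (1⊕ π)) id (0<tail zero))
    (≡.cong suc (count-cong (asc? (1⊕ π)) (asc? π) suc id λ i → tail-< zero π (inject₁ i) (suc i)))

  des-1⊕ : des (1⊕ π) ≡ des π
  des-1⊕ = ≡.trans (count-reject (des? (1⊕ π)) id (ℕ.<⇒≯ (0<tail zero)))
    (count-cong (des? (1⊕ π)) (des? π) suc id λ i → tail-< zero π (suc i) (inject₁ i))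

  lrmax-1⊕ : lrmax (1⊕ π) ≡ suc (lrmax π)
  lrmax-1⊕ = ≡.trans (count-accept (lrmax? (1⊕ π)) id λ _ ())
    (≡.cong suc (count-cong (lrmax? (1⊕ π)) (lrmax? π) suc id λ i → mk⇔
      (λ m j j<i → to (tail-< zero π j i) (m (suc j) (s≤s j<i)))
      (λ { m zero _ → 0<tail i ; m (suc j) (s≤s j<i) → from (tail-< zero π j i) (m j j<i) })))

  -- No letter after the new least letter can be a left-to-right minimum. This reset is what brings
  -- `s = 1` into the recurrence.
  lrmin-1⊕ : lrmin (1⊕ π) ≡ 1
  lrmin-1⊕ = ≡.trans (count-accept (lrmin? (1⊕ π)) id λ _ ())
    (≡.cong suc (count-none (lrmin? (1⊕ π)) suc λ i m → ℕ.<⇒≯ (0<tail i) (m zero (s≤s z≤n))))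

  -- Since `π` is nonempty, the new least letter has a larger one to its right; the other positions
  -- look only to the right and do not see it.
  rlmax-1⊕ : rlmax (1⊕ π) ≡ rlmax π
  rlmax-1⊕ = ≡.trans
    (count-reject (rlmax? (1⊕ π)) id λ m → ℕ.<⇒≯ (0<tail zero) (m (suc zero) (s≤s z≤n)))
    (count-cong (rlmax? (1⊕ π)) (rlmax? π) suc id λ i → mk⇔
      (λ m j i<j → to (tail-< zero π j i) (m (suc j) (s≤s i<j)))
      (λ { m (suc j) (s≤s i<j) → from (tail-< zero π j i) (m j i<j) }))

  rlmin-1⊕ : rlmin (1⊕ π) ≡ suc (rlmin π)
  rlmin-1⊕ = ≡.trans (count-accept (rlmin? (1⊕ π)) id λ { (suc j) _ → 0<tail j })
    (≡.cong suc (count-cong (rlmin? (1⊕ π)) (rlmin? π) suc id λ i → mk⇔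
      (λ m j i<j → to (tail-< zero π i j) (m (suc j) (s≤s i<j)))
      (λ { m (suc j) (s≤s i<j) → from (tail-< zero π i j) (m j i<j) })))

  private
    h : Fin (suc (suc n))
    h = suc (lookup π zero)

  tail≤first : ∀ i →
               lookup (enlarge π) (suc i) < lookup (enlarge π) zero ⇔ lookup π i ≤ lookup π zero
  tail≤first i = mk⇔ (λ x<h → ℕ.s≤s⁻¹ (to (tail<h h π i) x<h)) (λ x≤ → from (tail<h h π i) (s≤s x≤))

  second<first : lookup (enlarge π) (suc zero) < lookup (enlarge π) zero
  second<first = from (tail≤first zero) ℕ.≤-refl

  asc-enlarge : asc (enlarge π) ≡ asc π
  asc-enlarge = ≡.trans (count-reject (asc? (enlarge π)) id (ℕ.<⇒≯ second<first))
    (count-cong (asc? (enlarge π)) (asc? π) suc id λ i → tail-< h π (inject₁ i) (suc i))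

  des-enlarge : des (enlarge π) ≡ suc (des π)
  des-enlarge = ≡.trans (count-accept (des? (enlarge π)) id second<first)
    (≡.cong suc (count-cong (des? (enlarge π)) (des? π) suc id λ i →
      tail-< h π (suc i) (inject₁ i)))

  -- The new first letter takes over from the old one, which ceases to be a left-to-right maximum;
  -- all later positions keep their status.
  lrmax-enlarge : lrmax (enlarge π) ≡ lrmax π
  lrmax-enlarge = ≡.trans (count-accept (lrmax? (enlarge π)) id λ _ ()) (≡.trans
    (≡.cong suc (≡.trans
      (count-reject (lrmax? (enlarge π)) suc λ m → ℕ.<⇒≯ second<first (m zero (s≤s z≤n)))
      (count-cong (lrmax? (enlarge π)) (lrmax? π) (λ i → suc (suc i)) suc λ i → mk⇔
        (λ m j j<i → to (tail-< h π j (suc i)) (m (suc j) (s≤s j<i)))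
        -- A later left-to-right maximum of `π` exceeds `π₀`, so it is at least `h = π₀ + 1` and is
        -- moved above the new first letter.
        (λ { m zero    _         → from (h<tail h π (suc i)) (m zero (s≤s z≤n))
           ; m (suc j) (s≤s j<i) → from (tail-< h π j (suc i)) (m j j<i) }))))
    (≡.sym (count-accept (lrmax? π) id λ _ ())))

  -- A left-to-right minimum of `π` is at most `π₀`, hence stays below the new first letter, which
  -- is itself one more left-to-right minimum.
  lrmin-enlarge : lrmin (enlarge π) ≡ suc (lrmin π)
  lrmin-enlarge = ≡.trans (count-accept (lrmin? (enlarge π)) id λ _ ())
    (≡.cong suc (count-cong (lrmin? (enlarge π)) (lrmin? π) suc id λ i → mk⇔
      (λ m j j<i → to (tail-< h π i j) (m (suc j) (s≤s j<i)))
      (λ { m zero    _         → from (tail≤first i) (lrmin⇒≤first i m)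
         ; m (suc j) (s≤s j<i) → from (tail-< h π i j) (m j j<i) })))
    where
    lrmin⇒≤first : ∀ i → (∀ j → j < i → lookup π i < lookup π j) → lookup π i ≤ lookup π zero
    lrmin⇒≤first zero    m = ℕ.≤-refl
    lrmin⇒≤first (suc i) m = ℕ.<⇒≤ (m zero (s≤s z≤n))

  rlmin-enlarge : rlmin (enlarge π) ≡ rlmin π
  rlmin-enlarge = ≡.trans
    (count-reject (rlmin? (enlarge π)) id λ m → ℕ.<⇒≯ second<first (m (suc zero) (s≤s z≤n)))
    (count-cong (rlmin? (enlarge π)) (rlmin? π) suc id λ i → mk⇔
      (λ m j i<j → to (tail-< h π i j) (m (suc j) (s≤s i<j)))
      (λ { m (suc j) (s≤s i<j) → from (tail-< h π i j) (m j i<j) }))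

  private
    rlmax-tail : ∀ i → (∀ j → suc i < j → lookup (enlarge π) j < lookup (enlarge π) (suc i)) ⇔
                       (∀ j → i < j → lookup π j < lookup π i)
    rlmax-tail i = mk⇔
      (λ m j i<j → to (tail-< h π j i) (m (suc j) (s≤s i<j)))
      (λ { m (suc j) (s≤s i<j) → from (tail-< h π j i) (m j i<j) })

  -- The new first letter exceeds exactly the letters of `π` that are at most `π₀`. So it is a
  -- right-to-left maximum precisely when `π` begins with its largest letter; for layered `π` this
  -- means a single block.
  rlmax-enlarge-max : (∀ j → lookup π j ≤ lookup π zero) → rlmax (enlarge π) ≡ suc (rlmax π)
  rlmax-enlarge-max max = ≡.trans
    (count-accept (rlmax? (enlarge π)) id λ { (suc j) _ → from (tail≤first j) (max j) })
    (≡.cong suc (count-cong (rlmax? (enlarge π)) (rlmax? π) suc id rlmax-tail))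

  rlmax-enlarge-nonmax : ∃ (λ j → lookup π zero < lookup π j) → rlmax (enlarge π) ≡ rlmax π
  rlmax-enlarge-nonmax (j , first<) = ≡.trans
    (count-reject (rlmax? (enlarge π)) id λ m → ℕ.<⇒≱ first< (to (tail≤first j) (m (suc j) (s≤s z≤n))))
    (count-cong (rlmax? (enlarge π)) (rlmax? π) suc id rlmax-tail)

-- Permutations avoiding 231 and 312

-- `w` sends each letter of the pattern to the letter of `π` in its role. By trichotomy a strictly
-- monotone map also reflects the order, which gives both directions of the equivalence.
occurrence : {τ : Vec (Fin k) k} {π : Vec (Fin n) n} {is : Vec (Fin n) k} (w : Fin k → Fin n) →
             AllPairs _<_ is → (∀ {x y} → x < y → w x < w y) →
             (∀ x → lookup π (lookup is x) ≡ w (lookup τ x)) → IsOccurrence τ π is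
occurrence {τ = τ} w is< w-mono eq = is< , λ x y →
  ≡.subst₂ (λ fx fy → fx < fy ⇔ lookup τ x < lookup τ y) (≡.sym (eq x)) (≡.sym (eq y))
    (mk⇔ (w-cancel (lookup τ x) (lookup τ y)) w-mono)
  where
  w-cancel : ∀ x y → w x < w y → x < y
  w-cancel x y wx<wy with Fin.<-cmp x y
  ... | tri< x<y _ _  = x<y
  ... | tri≈ _ ≡.refl _ = contradiction wx<wy (ℕ.<-irrefl ≡.refl)
  ... | tri> _ _ y<x  = contradiction wx<wy (ℕ.<⇒≯ (w-mono y<x))

triple-mono : {x y z : Fin n} → x < y → y < z →
              ∀ {i j : Fin 3} → i < j → lookup (x ∷ y ∷ z ∷ []) i < lookup (x ∷ y ∷ z ∷ []) j
triple-mono x<y y<z {0F} {1F} _ = x<y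
triple-mono x<y y<z {0F} {2F} _ = ℕ.<-trans x<y y<z
triple-mono x<y y<z {1F} {2F} _ = y<z
triple-mono x<y y<z {1F} {1F} (s≤s ())
triple-mono x<y y<z {2F} {1F} (s≤s ())
triple-mono x<y y<z {2F} {2F} (s≤s (s≤s ()))

triple-AllPairs : {x y z : Fin n} → x < y → y < z → AllPairs _<_ (x ∷ y ∷ z ∷ [])
triple-AllPairs x<y y<z = (x<y ∷ ℕ.<-trans x<y y<z ∷ []) ∷ (y<z ∷ []) ∷ [] ∷ []

module _ (π : Vec (Fin n) n) where

  -- Each pattern is expressed by a chain of two inequalities between letters; the third comparison
  -- follows by transitivity.
  Avoids231 Avoids312 : Set
  Avoids231 = ∀ i j k → i < j → j < k → lookup π k < lookup π i → ¬ lookup π i < lookup π j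
  Avoids312 = ∀ i j k → i < j → j < k → lookup π j < lookup π k → ¬ lookup π k < lookup π i

  avoids231⇔ : π Avoids [231] ⇔ Avoids231
  avoids231⇔ = mk⇔
    (λ av i j k i<j j<k πk<πi πi<πj → av (i ∷ j ∷ k ∷ [] ,
       -- The map inferred for `_` lists the three letters in increasing order: `π_k`, `π_i`, `π_j`.
       occurrence {τ = [231]} {π} _ (triple-AllPairs i<j j<k) (triple-mono πk<πi πi<πj)
         λ { 0F → ≡.refl ; 1F → ≡.refl ; 2F → ≡.refl }))
    (λ { av (i ∷ j ∷ k ∷ [] , (i<j ∷ _) ∷ (j<k ∷ _) ∷ _ , occ) →
       av i j k i<j j<k (from (occ 2F 0F) (s≤s z≤n)) (from (occ 0F 1F) (s≤s (s≤s z≤n))) })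

  avoids312⇔ : π Avoids [312] ⇔ Avoids312
  avoids312⇔ = mk⇔
    (λ av i j k i<j j<k πj<πk πk<πi → av (i ∷ j ∷ k ∷ [] ,
       occurrence {τ = [312]} {π} _ (triple-AllPairs i<j j<k) (triple-mono πj<πk πk<πi)
         λ { 0F → ≡.refl ; 1F → ≡.refl ; 2F → ≡.refl }))
    (λ { av (i ∷ j ∷ k ∷ [] , (i<j ∷ _) ∷ (j<k ∷ _) ∷ _ , occ) →
       av i j k i<j j<k (from (occ 1F 2F) (s≤s z≤n)) (from (occ 2F 0F) (s≤s (s≤s z≤n))) })

  record AvoidingPermutation : Set where
    constructor avoiding
    field
      unique    : Unique π
      avoids231 : Avoids231
      avoids312 : Avoids312

open AvoidingPermutation

-- Words with distinct letters

unique-map⁻ : {f : T → U} {xs : Vec T n} → Unique (map f xs) → Unique xs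
unique-map⁻ {xs = []}    []      = []
unique-map⁻ {xs = _ ∷ _} (≢ ∷ u) =
  All.map (λ fx≢fy → fx≢fy ∘ ≡.cong _) (All.map⁻ ≢) ∷ unique-map⁻ u

map-injective : {f : T → U} → (∀ {x y} → f x ≡ f y → x ≡ y) →
                {xs ys : Vec T n} → map f xs ≡ map f ys → xs ≡ ys
map-injective inj {[]}    {[]}    _  = ≡.refl
map-injective inj {_ ∷ _} {_ ∷ _} eq =
  let x≡y , xs≡ys = ∷-injective eq in ≡.cong₂ _∷_ (inj x≡y) (map-injective inj xs≡ys)

map-punchIn-surjective : ∀ (h : Fin (suc n)) {m} {w : Vec (Fin (suc n)) m} →
                         All (h ≢_) w → ∃ λ π → w ≡ map (punchIn h) π
map-punchIn-surjective h []         = [] , ≡.refl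
map-punchIn-surjective h (h≢x ∷ ≢s) =
  let π , w≡ = map-punchIn-surjective h ≢s in
  punchOut h≢x ∷ π , ≡.cong₂ _∷_ (≡.sym (Fin.punchIn-punchOut h≢x)) w≡

prepend-injective : ∀ {h h′ : Fin (suc n)} {π π′} → prepend h π ≡ prepend h′ π′ → h ≡ h′ × π ≡ π′
prepend-injective {h = h} eq with ∷-injective eq
... | ≡.refl , eq′ = ≡.refl , map-injective (Fin.punchIn-injective h _ _) eq′

prepend-unique : ∀ (h : Fin (suc n)) {π} → Unique π → Unique (prepend h π)
prepend-unique h u =
  All.map⁺ (All.universal (λ x → ≡.≢-sym (Fin.punchInᵢ≢i h x)) _) ∷
  Unique.map⁺ (Fin.punchIn-injective h _ _) u

-- Pigeonhole: if `y` were missed, punching it out would inject `suc n` positions into `n` letters.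
unique-surjective : {π : Vec (Fin n) n} → Unique π → ∀ y → ∃ λ i → lookup π i ≡ y
unique-surjective {suc n} {π} u y with any? (λ i → lookup π i ≟ y)
... | yes hit = hit
... | no miss = contradiction
  (Fin.injective⇒≤ {f = λ i → punchOut (y≢ i)} λ {i} {j} eq →
    Unique.lookup-injective u i j (Fin.punchOut-injective (y≢ i) (y≢ j) eq))
  ℕ.1+n≰n
  where
  y≢ : ∀ i → y ≢ lookup π i
  y≢ i y≡πᵢ = miss (i , ≡.sym y≡πᵢ)

-- Avoidance and the two growth steps

-- The first letter of either pattern has a smaller letter to its right, so the new least letter
-- takes part in no occurrence.
1⊕-avoiding : {π : Vec (Fin n) n} → AvoidingPermutation π → AvoidingPermutation (1⊕ π)
1⊕-avoiding {π = π} (avoiding u av231 av312) = avoiding (prepend-unique zero u)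
  (λ { (suc i) (suc j) (suc k) (s≤s i<j) (s≤s j<k) k<i i<j′ →
       av231 i j k i<j j<k (to (tail-< zero π k i) k<i) (to (tail-< zero π i j) i<j′) })
  (λ { (suc i) (suc j) (suc k) (s≤s i<j) (s≤s j<k) j<k′ k<i →
       av312 i j k i<j j<k (to (tail-< zero π j k) j<k′) (to (tail-< zero π k i) k<i) })

-- In an occurrence that starts at the new first letter `h`, the next position cannot be the second:
-- `π₀` is not above `h`, and no letter lies strictly between `π₀` and `h`. Hence `π₀` can replace
-- `h`, which gives an occurrence in `π`.
enlarge-avoiding : {π : Vec (Fin (suc n)) (suc n)} →
                   AvoidingPermutation π → AvoidingPermutation (enlarge π)
enlarge-avoiding {n} {π} (avoiding u av231 av312) = avoiding (prepend-unique h u)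
  (λ { zero (suc zero) (suc k) _ _ _ h<0 → ℕ.<⇒≯ h<0 (second<first π)
     ; zero (suc (suc j)) (suc k) _ (s≤s j<k) k<h h<j →
         av231 zero (suc j) k (s≤s z≤n) j<k (below k (ℕ.≤-trans (s≤s z≤n) j<k) k<h)
           (to (h<tail h π (suc j)) h<j)
     ; (suc i) (suc j) (suc k) (s≤s i<j) (s≤s j<k) k<i i<j′ →
         av231 i j k i<j j<k (to (tail-< h π k i) k<i) (to (tail-< h π i j) i<j′) })
  (λ { zero (suc zero) (suc k) _ (s≤s 0<k) 0<k′ k<h →
         ℕ.<⇒≱ (to (tail-< h π zero k) 0<k′) (to (tail≤first π k) k<h)
     ; zero (suc (suc j)) (suc k) _ (s≤s j<k) j<k′ k<h →
         av312 zero (suc j) k (s≤s z≤n) j<k (to (tail-< h π (suc j) k) j<k′)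
           (below k (ℕ.≤-trans (s≤s z≤n) j<k) k<h)
     ; (suc i) (suc j) (suc k) (s≤s i<j) (s≤s j<k) j<k′ k<i →
         av312 i j k i<j j<k (to (tail-< h π j k) j<k′) (to (tail-< h π k i) k<i) })
  where
  h : Fin (suc (suc n))
  h = suc (lookup π zero)
  -- Being below `h` gives only `π_k ≤ π₀`; distinctness of the letters makes it strict away from
  -- the first position.
  below : ∀ k → zero {n = n} < k → lookup (enlarge π) (suc k) < h → lookup π k < lookup π zero
  below k 0<k k<h = Fin.≤∧≢⇒< (to (tail≤first π k) k<h)
    λ πk≡π0 → ℕ.<⇒≢ 0<k (≡.cong toℕ (≡.sym (Unique.lookup-injective u k zero πk≡π0)))

prepend-avoiding⁻ : ∀ {h} {π : Vec (Fin n) n} →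
                    AvoidingPermutation (prepend h π) → AvoidingPermutation π
prepend-avoiding⁻ {h = h} {π} (avoiding (_ ∷ u) av231 av312) = avoiding (unique-map⁻ u)
  (λ i j k i<j j<k k<i i<j′ → av231 (suc i) (suc j) (suc k) (s≤s i<j) (s≤s j<k)
    (from (tail-< h π k i) k<i) (from (tail-< h π i j) i<j′))
  (λ i j k i<j j<k j<k′ k<i → av312 (suc i) (suc j) (suc k) (s≤s i<j) (s≤s j<k)
    (from (tail-< h π j k) j<k′) (from (tail-< h π k i) k<i))

data Grown {n} : Vec (Fin (suc (suc n))) (suc (suc n)) → Set where
  is-1⊕      : ∀ {π} → AvoidingPermutation π → Grown (1⊕ π)
  is-enlarge : ∀ {π} → AvoidingPermutation π → Grown (enlarge π)

-- A first letter h > 0 other than π₀ + 1 completes an occurrence of 231 with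
-- π₀ and 0 if it is smaller, and of 312 with π₀ and π₀ + 1 if it is larger.
prepend-grown : ∀ h {π : Vec (Fin (suc n)) (suc n)} →
                AvoidingPermutation (prepend h π) → Grown (prepend h π)
prepend-grown zero av = is-1⊕ (prepend-avoiding⁻ av)
prepend-grown {n} (suc h) {π} av with Fin.<-cmp h (lookup π zero)
... | tri≈ _ ≡.refl _ = is-enlarge (prepend-avoiding⁻ av)
... | tri< h<π₀ _ _   = found (unique-surjective (unique (prepend-avoiding⁻ av)) zero)
  where
  found : ∃ (λ k → lookup π k ≡ zero) → Grown (prepend (suc h) π)
  found (zero  , π₀≡0) = contradiction (ℕ.≤-trans (s≤s z≤n) h<π₀)
    (ℕ.≤⇒≯ (ℕ.≤-reflexive (≡.cong toℕ π₀≡0)))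
  found (suc k , πₖ≡0) = ⊥-elim (avoids231 av 0F 1F (suc (suc k)) (s≤s z≤n) (s≤s (s≤s z≤n))
    (from (tail<h (suc h) π (suc k)) (≡.subst (_< suc h) (≡.sym πₖ≡0) (s≤s z≤n)))
    (from (h<tail (suc h) π zero) h<π₀))
... | tri> _ _ π₀<h   =
  found (unique-surjective (unique (prepend-avoiding⁻ av)) (fromℕ< 1+π₀<))
  where
  -- `π₀ < h` means `π₀ + 1 ≤ h`, so `π₀ + 1` is still a letter of `π`, and it occurs somewhere.
  1+π₀< : suc (toℕ (lookup π zero)) ℕ.< suc n
  1+π₀< = ℕ.≤-<-trans π₀<h (Fin.toℕ<n h)
  found : ∃ (λ k → lookup π k ≡ fromℕ< 1+π₀<) → Grown (prepend (suc h) π)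
  found (k , πₖ≡) with ≡.trans (≡.cong toℕ πₖ≡) (Fin.toℕ-fromℕ< 1+π₀<)
  found (zero  , _) | eq = contradiction (≡.sym eq) ℕ.1+n≢n
  found (suc k , _) | eq =
    ⊥-elim (avoids312 av 0F 1F (suc (suc k)) (s≤s z≤n) (s≤s (s≤s z≤n))
      (from (tail-< (suc h) π zero (suc k)) (ℕ.≤-reflexive (≡.sym eq)))
      (from (tail<h (suc h) π (suc k)) (s≤s (ℕ.≤-trans (ℕ.≤-reflexive eq) π₀<h))))

avoiding-grown : {π : Vec (Fin (suc (suc n))) (suc (suc n))} → AvoidingPermutation π → Grown π
avoiding-grown {π = h ∷ w} av@(avoiding (h≢ ∷ _) _ _) with map-punchIn-surjective h h≢
... | π , ≡.refl = prepend-grown h av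

-- The list of layered permutations

layered : ∀ n → List (Vec (Fin (suc n)) (suc n))
layered n = decreasing n List.∷ multilayered n

-- Induction on the length via `avoiding-grown`: enlarging the head of the list gives the next head,
-- and every other growth step lands in `multilayered`.
layered-complete : ∀ n {π} → AvoidingPermutation π → π ∈ layered n
layered-complete zero    {zero ∷ []} av = here ≡.refl
layered-complete (suc n) av with avoiding-grown av
... | is-1⊕ av′ = there (∈-++⁺ˡ (∈-map⁺ 1⊕_ (layered-complete n av′)))
... | is-enlarge av′ with layered-complete n av′
...   | here ≡.refl = here ≡.refl
...   | there π∈  = there (∈-++⁺ʳ (List.map 1⊕_ (layered n)) (∈-map⁺ enlarge π∈))

layered-sound : ∀ n → ListAll.All AvoidingPermutation (layered n)
layered-sound zero    = avoiding ([] ∷ []) (λ { zero zero _ () }) (λ { zero zero _ () }) ∷ []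
layered-sound (suc n) with layered-sound n
... | dec ∷ rest = enlarge-avoiding dec ∷ ListAll.++⁺
  (ListAll.map⁺ (ListAll.map 1⊕-avoiding (dec ∷ rest)))
  (ListAll.map⁺ (ListAll.map enlarge-avoiding rest))

-- Both growth steps are injective, and their images are disjoint because the first letter is `zero`
-- for one and a successor for the other.
layered-unique : ∀ n → ListUnique.Unique (layered n)
layered-unique zero    = [] ∷ []
layered-unique (suc n) with layered-unique n
... | dec∉ ∷ u =
  ListAll.++⁺ (ListAll.map⁺ (ListAll.universal (λ π ()) _))
              (ListAll.map⁺ (ListAll.map (λ ≢ eq → ≢ (proj₂ (prepend-injective eq))) dec∉)) ∷
  ListUnique.++⁺ (ListUnique.map⁺ (proj₂ ∘ prepend-injective) (dec∉ ∷ u))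
                 (ListUnique.map⁺ (proj₂ ∘ prepend-injective) u)
                 (λ (∈1⊕ , ∈enlarge) → disjoint (∈-map⁻ 1⊕_ ∈1⊕) (∈-map⁻ enlarge ∈enlarge))
  where
  disjoint : ∀ {π : Vec (Fin (suc (suc n))) (suc (suc n))} →
             ∃ (λ ρ → ρ ∈ layered n × π ≡ 1⊕ ρ) → ¬ ∃ (λ σ → σ ∈ multilayered n × π ≡ enlarge σ)
  disjoint (_ , _ , ≡.refl) (_ , _ , ())

-- Comparison with the filtered list `S`

words-complete : ∀ n k (w : Vec (Fin n) k) → w ∈ words n k
words-complete n zero    []      = here ≡.refl
words-complete n (suc k) (x ∷ w) = ∈-cartesianProductWith⁺ _∷_ (∈-allFin x) (words-complete n k w)

words-unique : ∀ n k → ListUnique.Unique (words n k)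
words-unique n zero    = [] ∷ []
words-unique n (suc k) =
  ListUnique.cartesianProductWith⁺ _∷_ ∷-injective (ListUnique.allFin⁺ n) (words-unique n k)

module _ (τ : Vec (Fin k) k) (ρ : Vec (Fin m) m) where

  avoidsBoth? : Decidable {A = Vec (Fin n) n} λ π → π Avoids τ × π Avoids ρ
  avoidsBoth? π = (π avoids? τ) ×-dec (π avoids? ρ)

  ∈S⇔ : {π : Vec (Fin n) n} → π ∈ S n τ ρ ⇔ (Unique π × π Avoids τ × π Avoids ρ)
  ∈S⇔ {n} {π} = mk⇔
    (λ π∈S → let π∈ , av = ∈-filter⁻ avoidsBoth? {v = π} {xs = permutations n} π∈S
             in proj₂ (∈-filter⁻ isPermutation? {v = π} {xs = words n n} π∈) , av)
    (λ (u , av) → ∈-filter⁺ avoidsBoth? (∈-filter⁺ isPermutation? (words-complete n n π) u) av)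

  S-unique : ∀ n → ListUnique.Unique (S n τ ρ)
  S-unique n = ListUnique.filter⁺ avoidsBoth? (ListUnique.filter⁺ isPermutation? (words-unique n n))

∈S⇔avoiding : {π : Vec (Fin n) n} → π ∈ S n [231] [312] ⇔ AvoidingPermutation π
∈S⇔avoiding {π = π} = mk⇔
  (λ π∈S → let u , av231 , av312 = to (∈S⇔ [231] [312] {π = π}) π∈S
           in avoiding u (to (avoids231⇔ π) av231) (to (avoids312⇔ π) av312))
  (λ (avoiding u av231 av312) →
    from (∈S⇔ [231] [312] {π = π}) (u , from (avoids231⇔ π) av231 , from (avoids312⇔ π) av312))

-- Two lists without repetition that have the same members are rearrangements of each other.
S↭layered : ∀ n → S (suc n) [231] [312] ↭ layered n
S↭layered n = ∼bag⇒↭ (unique∧set⇒bag (S-unique [231] [312] (suc n)) (layered-unique n)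
  (mk⇔ (layered-complete n ∘ to ∈S⇔avoiding)
       (from ∈S⇔avoiding ∘ ListAll.lookup (layered-sound n))))

-- Power series and the linear system

module IntegerCoefficientSolver (R : CommutativeRing c ℓ) where
  open CommutativeRing R
  open Mult semiring renaming (_×_ to infixl 8 _·_)
  open RingProperties ring using (-‿distribˡ-*; -‿distribʳ-*; -0#≈0#; -‿involutive)
  open AbelianGroupProperties +-abelianGroup using (⁻¹-∙-comm; xyx⁻¹≈y)
  open SetoidReasoning setoid

  -- The canonical homomorphism from the integers. Integer coefficients have decidable equality, so
  -- the solver can cancel terms even though equality in `R` need not be decidable.
  ⟦_⟧ℤ : ℤ → Carrier
  ⟦ + n      ⟧ℤ = n · 1#
  ⟦ -[1+ n ] ⟧ℤ = - (suc n · 1#)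

  neg-homo : ∀ i → ⟦ ℤ.- i ⟧ℤ ≈ - ⟦ i ⟧ℤ
  neg-homo +0       = sym -0#≈0#
  neg-homo +[1+ n ] = refl
  neg-homo -[1+ n ] = sym (-‿involutive _)

  ⊖-homo : ∀ m n → ⟦ m ℤ.⊖ n ⟧ℤ ≈ m · 1# - n · 1#
  ⊖-homo m       zero    = sym (trans (+-congˡ -0#≈0#) (+-identityʳ _))
  ⊖-homo zero    (suc n) = sym (+-identityˡ _)
  ⊖-homo (suc m) (suc n) = begin
    ⟦ suc m ℤ.⊖ suc n ⟧ℤ                  ≡⟨ ≡.cong ⟦_⟧ℤ (ℤ.[1+m]⊖[1+n]≡m⊖n m n) ⟩
    ⟦ m ℤ.⊖ n ⟧ℤ                          ≈⟨ ⊖-homo m n ⟩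
    m · 1# - n · 1#                       ≈⟨ +-congʳ (xyx⁻¹≈y 1# (m · 1#)) ⟨
    1# + m · 1# - 1# - n · 1#             ≈⟨ +-assoc _ _ _ ⟩
    1# + m · 1# + (- 1# - n · 1#)         ≈⟨ +-congˡ (⁻¹-∙-comm _ _) ⟩
    1# + m · 1# - (1# + n · 1#)           ≈⟨ +-cong (1+× m 1#) (-‿cong (1+× n 1#)) ⟨
    suc m · 1# - suc n · 1#               ∎

  +-homo : ∀ i j → ⟦ i ℤ.+ j ⟧ℤ ≈ ⟦ i ⟧ℤ + ⟦ j ⟧ℤ
  +-homo (+ m)    (+ n)    = ×-homo-+ 1# m n
  +-homo (+ m)    -[1+ n ] = ⊖-homo m (suc n)
  +-homo -[1+ m ] (+ n)    = trans (⊖-homo n (suc m)) (+-comm _ _)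
  +-homo -[1+ m ] -[1+ n ] = begin
    - (suc (suc (m ℕ.+ n)) · 1#)          ≡⟨ ≡.cong (λ k → - (suc k · 1#)) (ℕ.+-suc m n) ⟨
    - ((suc m ℕ.+ suc n) · 1#)            ≈⟨ -‿cong (×-homo-+ 1# (suc m) (suc n)) ⟩
    - (suc m · 1# + suc n · 1#)           ≈⟨ ⁻¹-∙-comm _ _ ⟨
    - (suc m · 1#) - (suc n · 1#)         ∎

  +*-homo : ∀ m j → ⟦ + m ℤ.* j ⟧ℤ ≈ ⟦ + m ⟧ℤ * ⟦ j ⟧ℤ
  +*-homo m (+ n) = begin
    ⟦ + m ℤ.* + n ⟧ℤ                      ≡⟨ ≡.cong ⟦_⟧ℤ (ℤ.pos-* m n) ⟨
    (m ℕ.* n) · 1#                        ≈⟨ ×1-homo-* m n ⟩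
    (m · 1#) * (n · 1#)                   ∎
  +*-homo m -[1+ n ] = begin
    ⟦ + m ℤ.* -[1+ n ] ⟧ℤ                 ≡⟨ ≡.cong ⟦_⟧ℤ (ℤ.neg-distribʳ-* (+ m) +[1+ n ]) ⟨
    ⟦ ℤ.- (+ m ℤ.* +[1+ n ]) ⟧ℤ           ≈⟨ neg-homo (+ m ℤ.* +[1+ n ]) ⟩
    - ⟦ + m ℤ.* +[1+ n ] ⟧ℤ               ≈⟨ -‿cong (+*-homo m +[1+ n ]) ⟩
    - (⟦ + m ⟧ℤ * ⟦ +[1+ n ] ⟧ℤ)          ≈⟨ -‿distribʳ-* _ _ ⟩
    ⟦ + m ⟧ℤ * ⟦ -[1+ n ] ⟧ℤ              ∎

  *-homo : ∀ i j → ⟦ i ℤ.* j ⟧ℤ ≈ ⟦ i ⟧ℤ * ⟦ j ⟧ℤ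
  *-homo (+ m)    j = +*-homo m j
  *-homo -[1+ m ] j = begin
    ⟦ -[1+ m ] ℤ.* j ⟧ℤ                   ≡⟨ ≡.cong ⟦_⟧ℤ (ℤ.neg-distribˡ-* +[1+ m ] j) ⟨
    ⟦ ℤ.- (+[1+ m ] ℤ.* j) ⟧ℤ             ≈⟨ neg-homo (+[1+ m ] ℤ.* j) ⟩
    - ⟦ +[1+ m ] ℤ.* j ⟧ℤ                 ≈⟨ -‿cong (+*-homo (suc m) j) ⟩
    - (⟦ +[1+ m ] ⟧ℤ * ⟦ j ⟧ℤ)            ≈⟨ -‿distribˡ-* _ _ ⟩
    ⟦ -[1+ m ] ⟧ℤ * ⟦ j ⟧ℤ                ∎

  morphism : ℤ.+-*-rawRing -Raw-AlmostCommutative⟶ fromCommutativeRing R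
  morphism = record
    { ⟦_⟧    = ⟦_⟧ℤ
    ; +-homo = +-homo
    ; *-homo = *-homo
    ; -‿homo = neg-homo
    ; 0-homo = refl
    ; 1-homo = refl
    }

  open RingSolver ℤ.+-*-rawRing (fromCommutativeRing R) morphism
    (λ i j → Maybe.map (λ i≡j → reflexive (≡.cong ⟦_⟧ℤ i≡j)) (dec⇒weaklyDec ℤ._≟_ i j)) public

-- The polynomial identity for the numerator

module RationalIdentity (R : CommutativeRing c ℓ) where
  open CommutativeRing R
  open IntegerCoefficientSolver R
  open SetoidReasoning setoid

  one : ∀ {n} → Polynomial n
  one = con (+ 1)

  -- The polynomial A of the theorem in solver syntax, so that its value at power
  -- series is A definitionally.
  numerator : ∀ {n} (x p q u v s t : Polynomial n) → Polynomial n
  numerator x p q u v s t =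
    one :- p :* t :* u :* x :+ s :* t :* u :* v :* x :+ q :^ 4 :* s :^ 2 :* v :^ 2 :* x :^ 4
    :+ q :^ 3 :* s :* v :* x :^ 3
      :* (:- one :- v :+ s :* (:- one :+ v :* (:- one :+ (:- one :+ p) :* t :* u :* x)))
    :- q :* x
      :* (one :+ v :- p :* t :* u :* v :* x
         :+ s :^ 2 :* t :* u :* v :* x :* (one :+ p :* t :* u :* (:- one :+ v) :* x)
         :+ s :* (one :+ v :- p :* t :* u :* x :- (:- one :+ p) :* t :* u :* v :* x
                :+ p :* t :^ 2 :* u :^ 2 :* v :* x :^ 2
                :+ t :* u :* v :^ 2 :* x :* (one :- p :* t :* u :* x)))
    :+ q :^ 2 :* x :^ 2
      :* (v :+ s :^ 2 :* v :* (one :+ t :* u :* (one :- p :+ v) :* x)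
         :+ s :* (one :+ v :^ 2 :* (one :- (:- one :+ p) :* t :* u :* x)
                :+ v :* (one :+ one :- p :* t :* u :* x)))

  -- The left-hand side is what `rational-solution` obtains from the generating function times the
  -- denominator once all unknown series are eliminated.
  numerator-expansion : ∀ x p q u v s t →
    let D₁ = 1# - q * s * x
        D₂ = 1# - q * x - p * t * u * x
        D₃ = 1# - q * v * x
        D₄ = 1# - q * s * v * x
    in D₁ * D₂ * D₃ * D₄ + x * (D₁ * D₂ * D₃) * (u * v * s * t)
       + x * x * (p * u * s * t) * D₄ * ((D₂ + x * (p * u * t)) * (u * v * t))
       ≈ ⟦ numerator (var 0F) (var 1F) (var 2F) (var 3F) (var 4F) (var 5F) (var 6F) ⟧
         (x ∷ p ∷ q ∷ u ∷ v ∷ s ∷ t ∷ [])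
  numerator-expansion = solve 7 (λ x p q u v s t →
    let D₁ = one :- q :* s :* x
        D₂ = one :- q :* x :- p :* t :* u :* x
        D₃ = one :- q :* v :* x
        D₄ = one :- q :* s :* v :* x
    in D₁ :* D₂ :* D₃ :* D₄ :+ x :* (D₁ :* D₂ :* D₃) :* (u :* v :* s :* t)
       :+ x :* x :* (p :* u :* s :* t) :* D₄ :* ((D₂ :+ x :* (p :* u :* t)) :* (u :* v :* t))
       := numerator x p q u v s t) refl

-- The ring of formal power series

module PowerSeriesProperties (R : CommutativeRing c ℓ) where
  private module R = CommutativeRing R
  open PowerSeries R
  open CommutativeSemigroupProperties R.+-commutativeSemigroup using (x∙yz≈y∙xz; interchange)
  open AbelianGroupProperties R.+-abelianGroup using (xyx⁻¹≈y)
  open SetoidReasoning R.setoid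

  -- By definition `(f * g) (suc n)` unfolds to `f 0 R.* g (suc n) R.+ ((f ∘ suc) * g) n`; this and
  -- the following laws use induction on the index with the left factor varying.
  *-cong : ∀ {f f′ g g′} → f ≈ f′ → g ≈ g′ → f * g ≈ f′ * g′
  *-cong f≈ g≈ zero    = R.+-congʳ (R.*-cong (f≈ 0) (g≈ 0))
  *-cong f≈ g≈ (suc n) = R.+-cong (R.*-cong (f≈ 0) (g≈ (suc n))) (*-cong (f≈ ∘ suc) g≈ n)

  *-distribʳ-+ : ∀ h f g → (f + g) * h ≈ f * h + g * h
  *-distribʳ-+ h f g zero    = begin
    (f 0 R.+ g 0) R.* h 0 R.+ R.0#
      ≈⟨ R.+-cong (R.distribʳ _ _ _) (R.sym (R.+-identityˡ _)) ⟩
    f 0 R.* h 0 R.+ g 0 R.* h 0 R.+ (R.0# R.+ R.0#)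
      ≈⟨ interchange _ _ _ _ ⟩
    f 0 R.* h 0 R.+ R.0# R.+ (g 0 R.* h 0 R.+ R.0#)
      ∎
  *-distribʳ-+ h f g (suc n) =
    R.trans (R.+-cong (R.distribʳ _ _ _) (*-distribʳ-+ h (f ∘ suc) (g ∘ suc) n))
            (interchange _ _ _ _)

  *-scaleˡ : ∀ r f g → (λ n → r R.* f n) * g ≈ λ n → r R.* (f * g) n
  *-scaleˡ r f g zero    = begin
    r R.* f 0 R.* g 0 R.+ R.0#       ≈⟨ R.+-identityʳ _ ⟩
    r R.* f 0 R.* g 0                ≈⟨ R.*-assoc _ _ _ ⟩
    r R.* (f 0 R.* g 0)              ≈⟨ R.*-congˡ (R.+-identityʳ _) ⟨
    r R.* (f 0 R.* g 0 R.+ R.0#)     ∎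
  *-scaleˡ r f g (suc n) =
    R.trans (R.+-cong (R.*-assoc _ _ _) (*-scaleˡ r (f ∘ suc) g n)) (R.sym (R.distribˡ _ _ _))

  *-zeroˡ : ∀ f → (λ _ → R.0#) * f ≈ λ _ → R.0#
  *-zeroˡ f zero    = R.trans (R.+-identityʳ _) (R.zeroˡ _)
  *-zeroˡ f (suc n) = R.trans (R.+-cong (R.zeroˡ _) (*-zeroˡ f n)) (R.+-identityˡ _)

  C*≈ : ∀ r f → C r * f ≈ λ n → r R.* f n
  C*≈ r f zero    = R.+-identityʳ _
  C*≈ r f (suc n) = R.trans (R.+-congˡ (*-zeroˡ f n)) (R.+-identityʳ _)

  -- The product is computed by peeling off the constant term of the left
  -- factor; this is the same recursion on the right factor.
  *-sucʳ : ∀ f g n → (f * g) (suc n) R.≈ f (suc n) R.* g 0 R.+ (f * (g ∘ suc)) n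
  *-sucʳ f g zero    = begin
    f 0 R.* g 1 R.+ (f 1 R.* g 0 R.+ R.0#)   ≈⟨ x∙yz≈y∙xz _ _ _ ⟩
    f 1 R.* g 0 R.+ (f 0 R.* g 1 R.+ R.0#)   ∎
  *-sucʳ f g (suc n) = R.trans (R.+-congˡ (*-sucʳ (f ∘ suc) g n)) (x∙yz≈y∙xz _ _ _)

  *-comm : ∀ f g → f * g ≈ g * f
  *-comm f g zero    = R.+-congʳ (R.*-comm _ _)
  *-comm f g (suc n) = begin
    f 0 R.* g (suc n) R.+ ((f ∘ suc) * g) n   ≈⟨ R.+-cong (R.*-comm _ _) (*-comm (f ∘ suc) g n) ⟩
    g (suc n) R.* f 0 R.+ (g * (f ∘ suc)) n   ≈⟨ *-sucʳ g f n ⟨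
    (g * f) (suc n)                           ∎

  *-assoc : ∀ f g h → (f * g) * h ≈ f * (g * h)
  *-assoc f g h zero    = begin
    (f 0 R.* g 0 R.+ R.0#) R.* h 0 R.+ R.0#     ≈⟨ R.+-congʳ (R.*-congʳ (R.+-identityʳ _)) ⟩
    f 0 R.* g 0 R.* h 0 R.+ R.0#                ≈⟨ R.+-congʳ (R.*-assoc _ _ _) ⟩
    f 0 R.* (g 0 R.* h 0) R.+ R.0#              ≈⟨ R.+-congʳ (R.*-congˡ (R.+-identityʳ _)) ⟨
    f 0 R.* (g 0 R.* h 0 R.+ R.0#) R.+ R.0#     ∎
  *-assoc f g h (suc n) = begin
    -- The tail of `f * g` is the sum of a multiple of `g ∘ suc` and a product with left factor
    -- `f ∘ suc`; the induction hypothesis applies to the latter.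
    (f 0 R.* g 0 R.+ R.0#) R.* h (suc n) R.+ ((λ k → f 0 R.* g (suc k) R.+ ((f ∘ suc) * g) k) * h) n
      ≈⟨ R.+-cong (R.trans (R.*-congʳ (R.+-identityʳ _)) (R.*-assoc _ _ _))
                  (*-distribʳ-+ h (λ k → f 0 R.* g (suc k)) ((f ∘ suc) * g) n) ⟩
    f 0 R.* (g 0 R.* h (suc n)) R.+ (((λ k → f 0 R.* g (suc k)) * h) n R.+ (((f ∘ suc) * g) * h) n)
      ≈⟨ R.+-congˡ (R.+-cong (*-scaleˡ (f 0) (g ∘ suc) h n) (*-assoc (f ∘ suc) g h n)) ⟩
    f 0 R.* (g 0 R.* h (suc n)) R.+ (f 0 R.* ((g ∘ suc) * h) n R.+ ((f ∘ suc) * (g * h)) n)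
      ≈⟨ R.+-assoc _ _ _ ⟨
    f 0 R.* (g 0 R.* h (suc n)) R.+ f 0 R.* ((g ∘ suc) * h) n R.+ ((f ∘ suc) * (g * h)) n
      ≈⟨ R.+-congʳ (R.distribˡ _ _ _) ⟨
    (f * (g * h)) (suc n)
      ∎

  commutativeRing : CommutativeRing c ℓ
  commutativeRing = record
    { Carrier = Series ; _≈_ = _≈_ ; _+_ = _+_ ; _*_ = _*_ ; -_ = -_ ; 0# = 0# ; 1# = 1#
    ; isCommutativeRing = record
      { isRing = record
        { +-isAbelianGroup = record
          { isGroup = record
            { isMonoid = record
              { isSemigroup = record
                { isMagma = record
                  { isEquivalence = record
                    { refl  = λ n → R.refl
                    ; sym   = λ f≈g n → R.sym (f≈g n)
                    ; trans = λ f≈g g≈h n → R.trans (f≈g n) (g≈h n)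
                    }
                  ; ∙-cong = λ f≈ g≈ n → R.+-cong (f≈ n) (g≈ n)
                  }
                ; assoc = λ f g h n → R.+-assoc _ _ _
                }
              ; identity = (λ f n → R.trans (R.+-congʳ (0#-coeff n)) (R.+-identityˡ _))
                         , (λ f n → R.trans (R.+-congˡ (0#-coeff n)) (R.+-identityʳ _))
              }
            ; inverse = (λ f n → R.trans (R.-‿inverseˡ _) (R.sym (0#-coeff n)))
                      , (λ f n → R.trans (R.-‿inverseʳ _) (R.sym (0#-coeff n)))
            ; ⁻¹-cong = λ f≈g n → R.-‿cong (f≈g n)
            }
          ; comm = λ f g n → R.+-comm _ _
          }
        ; *-cong = *-cong
        ; *-assoc = *-assoc
        ; *-identity = *-identityˡ
                     , (λ f n → R.trans (*-comm f 1# n) (*-identityˡ f n))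
        ; distrib = (λ f g h n → begin
                      (f * (g + h)) n            ≈⟨ *-comm f (g + h) n ⟩
                      ((g + h) * f) n            ≈⟨ *-distribʳ-+ f g h n ⟩
                      (g * f) n R.+ (h * f) n    ≈⟨ R.+-cong (*-comm g f n) (*-comm h f n) ⟩
                      (f * g) n R.+ (f * h) n    ∎)
                  , *-distribʳ-+
        }
      ; *-comm = *-comm
      }
    }
    where
    -- The series `0#` is `C R.0#`, whose coefficients reduce only after a case split on the index.
    0#-coeff : ∀ n → 0# n R.≈ R.0#
    0#-coeff zero    = R.refl
    0#-coeff (suc n) = R.refl
    *-identityˡ : ∀ f → 1# * f ≈ f
    *-identityˡ f n = R.trans (C*≈ R.1# f n) (R.*-identityˡ _)

  X*-zero : ∀ f → (X * f) 0 R.≈ R.0#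
  X*-zero f = R.trans (R.+-identityʳ _) (R.zeroˡ _)

  X*-suc : ∀ f n → (X * f) (suc n) R.≈ f n
  X*-suc f n = begin
    R.0# R.* f (suc n) R.+ ((X ∘ suc) * f) n
      ≈⟨ R.+-cong (R.zeroˡ _) (*-cong {g = f} X∘suc≈1 (λ _ → R.refl) n) ⟩
    R.0# R.+ (C R.1# * f) n
      ≈⟨ R.+-identityˡ _ ⟩
    (C R.1# * f) n
      ≈⟨ C*≈ R.1# f n ⟩
    R.1# R.* f n
      ≈⟨ R.*-identityˡ _ ⟩
    f n
      ∎
    where
    X∘suc≈1 : X ∘ suc ≈ C R.1#
    X∘suc≈1 zero    = R.refl
    X∘suc≈1 (suc n) = R.refl

  -- Induction along the long division: `h` and `f` have the same constant term since that of `g` is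
  -- 1, and `h ∘ suc` times `g` is the remainder with which the division goes on.
  /-unique : ∀ f g h → g 0 R.≈ R.1# → h * g ≈ f → h ≈ f / g
  /-unique f g h g₀≈1 hg≈f zero = begin
    h 0                        ≈⟨ R.*-identityʳ _ ⟨
    h 0 R.* R.1#               ≈⟨ R.*-congˡ g₀≈1 ⟨
    h 0 R.* g 0                ≈⟨ R.+-identityʳ _ ⟨
    h 0 R.* g 0 R.+ R.0#       ≈⟨ hg≈f 0 ⟩
    f 0                        ∎
  /-unique f g h g₀≈1 hg≈f (suc n) = /-unique _ g (h ∘ suc) g₀≈1 (λ k → begin
    ((h ∘ suc) * g) k
      ≈⟨ xyx⁻¹≈y (h 0 R.* g (suc k)) _ ⟨
    h 0 R.* g (suc k) R.+ ((h ∘ suc) * g) k R.- h 0 R.* g (suc k)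
      ≈⟨ R.+-cong (hg≈f (suc k)) (R.-‿cong (R.*-congʳ (/-unique f g h g₀≈1 hg≈f zero))) ⟩
    f (suc k) R.- f 0 R.* g (suc k)
      ∎) n

-- Solving the linear system

module RationalSolution (R : CommutativeRing c ℓ) where
  open CommutativeRing R
  open IntegerCoefficientSolver R
  open RationalIdentity R
  open SetoidReasoning setoid

  isolate : ∀ {a b r} → a ≈ b + r * a → (1# - r) * a ≈ b
  isolate {a} {b} {r} a≈b+ra = begin
    (1# - r) * a          ≈⟨ solve 2 (λ a r → (one :- r) :* a := a :- r :* a) refl a r ⟩
    a - r * a             ≈⟨ +-congʳ a≈b+ra ⟩
    b + r * a - r * a     ≈⟨ solve 3 (λ a b r → b :+ r :* a :- r :* a := b) refl a b r ⟩
    b                     ∎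

  -- δ₁ and μ₁ stand for δ and μ at s = 1.
  rational-solution : ∀ x p q u v s t {δ δ₁ μ μ₁} →
    δ  ≈ u * v * s * t  + x * (q * v * s * δ) →
    δ₁ ≈ u * v * 1# * t + x * (q * v * 1# * δ₁) →
    μ  ≈ x * (p * u * t * s * (δ₁ + μ₁) + q * s * μ) →
    μ₁ ≈ x * (p * u * t * 1# * (δ₁ + μ₁) + q * 1# * μ₁) →
    (1# + x * (δ + μ))
      * ((1# - q * s * x) * (1# - q * x - p * t * u * x) * (1# - q * v * x) * (1# - q * s * v * x))
    ≈ ⟦ numerator (var 0F) (var 1F) (var 2F) (var 3F) (var 4F) (var 5F) (var 6F) ⟧
        (x ∷ p ∷ q ∷ u ∷ v ∷ s ∷ t ∷ [])
  rational-solution x p q u v s t {δ} {δ₁} {μ} {μ₁} δ-eq δ₁-eq μ-eq μ₁-eq = begin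
    (1# + x * (δ + μ)) * (D₁ * D₂ * D₃ * D₄)
      -- Each factor of the denominator serves to eliminate one unknown: `D₄` goes with `δ`, `D₁`
      -- with `μ`, `D₂` with `μ₁` and `D₃` with `δ₁`.
      ≈⟨ solve 7 (λ x δ μ D₁ D₂ D₃ D₄ →
           (one :+ x :* (δ :+ μ)) :* (D₁ :* D₂ :* D₃ :* D₄)
           := D₁ :* D₂ :* D₃ :* D₄ :+ x :* (D₁ :* D₂ :* D₃) :* (D₄ :* δ)
              :+ x :* (D₂ :* D₃ :* D₄) :* (D₁ :* μ))
           refl x δ μ D₁ D₂ D₃ D₄ ⟩
    D₁ * D₂ * D₃ * D₄ + x * (D₁ * D₂ * D₃) * (D₄ * δ) + x * (D₂ * D₃ * D₄) * (D₁ * μ)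
      ≈⟨ +-cong (+-congˡ (*-congˡ D₄δ)) (*-congˡ D₁μ) ⟩
    D₁ * D₂ * D₃ * D₄ + x * (D₁ * D₂ * D₃) * (u * v * s * t)
      + x * (D₂ * D₃ * D₄) * (x * (p * u * s * t) * (δ₁ + μ₁))
      -- The remaining `D₂` and `D₃` are distributed so that `μ₁` is first expressed through `δ₁`,
      -- and then `δ₁` disappears.
      ≈⟨ +-congˡ (solve 7 (λ x k δ₁ μ₁ D₂ D₃ D₄ →
           x :* (D₂ :* D₃ :* D₄) :* (x :* k :* (δ₁ :+ μ₁))
           := x :* x :* k :* D₄ :* (D₂ :* (D₃ :* δ₁) :+ D₃ :* (D₂ :* μ₁)))
           refl x (p * u * s * t) δ₁ μ₁ D₂ D₃ D₄) ⟩
    D₁ * D₂ * D₃ * D₄ + x * (D₁ * D₂ * D₃) * (u * v * s * t)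
      + x * x * (p * u * s * t) * D₄ * (D₂ * (D₃ * δ₁) + D₃ * (D₂ * μ₁))
      ≈⟨ +-congˡ (*-congˡ (+-congˡ (*-congˡ D₂μ₁))) ⟩
    D₁ * D₂ * D₃ * D₄ + x * (D₁ * D₂ * D₃) * (u * v * s * t)
      + x * x * (p * u * s * t) * D₄ * (D₂ * (D₃ * δ₁) + D₃ * (x * (p * u * t) * δ₁))
      ≈⟨ +-congˡ (*-congˡ (solve 4 (λ k δ₁ D₂ D₃ →
           D₂ :* (D₃ :* δ₁) :+ D₃ :* (k :* δ₁) := (D₂ :+ k) :* (D₃ :* δ₁))
           refl (x * (p * u * t)) δ₁ D₂ D₃)) ⟩
    D₁ * D₂ * D₃ * D₄ + x * (D₁ * D₂ * D₃) * (u * v * s * t)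
      + x * x * (p * u * s * t) * D₄ * ((D₂ + x * (p * u * t)) * (D₃ * δ₁))
      ≈⟨ +-congˡ (*-congˡ (*-congˡ D₃δ₁)) ⟩
    D₁ * D₂ * D₃ * D₄ + x * (D₁ * D₂ * D₃) * (u * v * s * t)
      + x * x * (p * u * s * t) * D₄ * ((D₂ + x * (p * u * t)) * (u * v * t))
      ≈⟨ numerator-expansion x p q u v s t ⟩
    ⟦ numerator (var 0F) (var 1F) (var 2F) (var 3F) (var 4F) (var 5F) (var 6F) ⟧
      (x ∷ p ∷ q ∷ u ∷ v ∷ s ∷ t ∷ []) ∎
    where
    D₁ = 1# - q * s * x
    D₂ = 1# - q * x - p * t * u * x
    D₃ = 1# - q * v * x
    D₄ = 1# - q * s * v * x

    D₄δ : D₄ * δ ≈ u * v * s * t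
    D₄δ = isolate (trans δ-eq (solve 6 (λ x q v s c δ →
      c :+ x :* (q :* v :* s :* δ) := c :+ q :* s :* v :* x :* δ)
      refl x q v s (u * v * s * t) δ))

    D₃δ₁ : D₃ * δ₁ ≈ u * v * t
    D₃δ₁ = isolate (trans δ₁-eq (solve 6 (λ x q u v t δ₁ →
      u :* v :* one :* t :+ x :* (q :* v :* one :* δ₁) := u :* v :* t :+ q :* v :* x :* δ₁)
      refl x q u v t δ₁))

    D₁μ : D₁ * μ ≈ x * (p * u * s * t) * (δ₁ + μ₁)
    D₁μ = isolate (trans μ-eq (solve 8 (λ x p q u s t ν μ →
      x :* (p :* u :* t :* s :* ν :+ q :* s :* μ)
      := x :* (p :* u :* s :* t) :* ν :+ q :* s :* x :* μ)
      refl x p q u s t (δ₁ + μ₁) μ))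

    -- At `s = 1` the sum `δ₁ + μ₁` contains the unknown itself, so its coefficient `p * t * u * x`
    -- joins `q * x` in `D₂`.
    D₂μ₁ : D₂ * μ₁ ≈ x * (p * u * t) * δ₁
    D₂μ₁ = begin
      D₂ * μ₁
        ≈⟨ *-congʳ (solve 5 (λ x p q u t →
             one :- q :* x :- p :* t :* u :* x := one :- (q :* x :+ p :* t :* u :* x))
             refl x p q u t) ⟩
      (1# - (q * x + p * t * u * x)) * μ₁
        ≈⟨ isolate (trans μ₁-eq (solve 7 (λ x p q u t δ₁ μ₁ →
             x :* (p :* u :* t :* one :* (δ₁ :+ μ₁) :+ q :* one :* μ₁)
             := x :* (p :* u :* t) :* δ₁ :+ (q :* x :+ p :* t :* u :* x) :* μ₁)
             refl x p q u t δ₁ μ₁)) ⟩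
      x * (p * u * t) * δ₁ ∎

-- From recurrences for coefficients to the quotient

module LinearRecurrence (R : CommutativeRing c ℓ) where
  private
    module R = CommutativeRing R
  open PowerSeries R
  open PowerSeriesProperties R
  private
    module K = CommutativeRing commutativeRing

  open RingProperties R.ring using (-0#≈0#)

  C-*-homo : ∀ a b → C (a R.* b) ≈ C a * C b
  C-*-homo a b zero    = R.sym (C*≈ a (C b) 0)
  C-*-homo a b (suc n) = R.sym (R.trans (C*≈ a (C b) (suc n)) (R.zeroʳ a))

  shift : ∀ {f g} a → f 0 R.≈ a → (∀ n → f (suc n) R.≈ g n) → f ≈ C a + X * g
  shift {f} {g} a f₀ f₊ zero    =
    R.sym (R.trans (R.+-congˡ (X*-zero g)) (R.trans (R.+-identityʳ a) (R.sym f₀)))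
  shift {f} {g} a f₀ f₊ (suc n) =
    R.sym (R.trans (R.+-identityˡ _) (R.trans (X*-suc g n) (R.sym (f₊ n))))

  *-one : ∀ f g → f 0 R.≈ R.1# → g 0 R.≈ R.1# → (f * g) 0 R.≈ R.1#
  *-one f g f₀ g₀ = R.trans (R.+-identityʳ _) (R.trans (R.*-cong f₀ g₀) (R.*-identityʳ _))

  −X-one : ∀ f g → f 0 R.≈ R.1# → (f - g * X) 0 R.≈ R.1#
  −X-one f g f₀ = begin
    f 0 R.- (g * X) 0     ≈⟨ R.+-cong f₀ (R.-‿cong (R.trans (*-comm g X 0) (X*-zero g))) ⟩
    R.1# R.- R.0#         ≈⟨ R.+-congˡ -0#≈0# ⟩
    R.1# R.+ R.0#         ≈⟨ R.+-identityʳ _ ⟩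
    R.1#                  ∎
    where open SetoidReasoning R.setoid

  -- `δ` and `μ` are families in `s`, because the recurrence for `μ s` refers to the values at 1.
  module _ (p q u v t : R.Carrier) (δ μ : R.Carrier → Series)
    (δ-zero : ∀ s → δ s 0 R.≈ u R.* v R.* s R.* t)
    (δ-suc  : ∀ s n → δ s (suc n) R.≈ q R.* v R.* s R.* δ s n)
    (μ-zero : ∀ s → μ s 0 R.≈ R.0#)
    (μ-suc  : ∀ s n → μ s (suc n) R.≈
                p R.* u R.* t R.* s R.* (δ R.1# n R.+ μ R.1# n) R.+ q R.* s R.* μ s n)
    where
    C₂ : ∀ a b → C (a R.* b) ≈ C a * C b
    C₂ = C-*-homo
    C₃ : ∀ a b c → C (a R.* b R.* c) ≈ C a * C b * C c
    C₃ a b c = K.trans (C-*-homo (a R.* b) c) (K.*-congʳ {C c} (C-*-homo a b))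
    C₄ : ∀ a b c d → C (a R.* b R.* c R.* d) ≈ C a * C b * C c * C d
    C₄ a b c d = K.trans (C-*-homo (a R.* b R.* c) d) (K.*-congʳ {C d} (C₃ a b c))

    scale : ∀ {a b} f → C a ≈ b → (λ n → a R.* f n) ≈ b * f
    scale {a} {b} f a≈b = K.trans (K.sym (C*≈ a f)) (K.*-congʳ {f} a≈b)

    δ-series : ∀ s → δ s ≈ C u * C v * C s * C t + X * (C q * C v * C s * δ s)
    δ-series s = K.trans (shift (u R.* v R.* s R.* t) (δ-zero s) (δ-suc s))
      (K.+-cong (C₄ u v s t) (K.*-congˡ {X} (scale (δ s) (C₃ q v s))))

    μ-series : ∀ s → μ s ≈ X * (C p * C u * C t * C s * (δ R.1# + μ R.1#) + C q * C s * μ s)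
    μ-series s = K.trans (shift R.0# (μ-zero s) (μ-suc s)) (K.trans (K.+-identityˡ _)
      (K.*-congˡ {X} (K.+-cong (scale (δ R.1# + μ R.1#) (C₄ p u t s)) (scale (μ s) (C₂ q s)))))

    -- The hypotheses amount to `f ≈ 1# + X * (δ s + μ s)`. Its product with the denominator is `A`
    -- by `rational-solution`, and the quotient is unique because the denominator has constant term
    -- 1.
    quotient : ∀ s {f} → f 0 R.≈ R.1# → (∀ n → f (suc n) R.≈ δ s n R.+ μ s n) →
      f ≈ A R X (C p) (C q) (C u) (C v) (C s) (C t)
          / ((1# - C q * C s * X) * (1# - C q * X - C p * C t * C u * X)
             * (1# - C q * C v * X) * (1# - C q * C s * C v * X))
    quotient s {f} f-zero f-suc = /-unique _ D f D₀ (K.trans {f * D}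
      (K.*-congʳ {D} {f} (shift {g = δ s + μ s} R.1# f-zero f-suc))
      (RationalSolution.rational-solution commutativeRing X (C p) (C q) (C u) (C v) (C s) (C t)
        -- The series `1#` is `C R.1#`, so the instances at `R.1#` are the equations required of
        -- `δ₁` and `μ₁`.
        (δ-series s) (δ-series R.1#) (μ-series s) (μ-series R.1#)))
      where
      D₁ = 1# - C q * C s * X
      D₂ = 1# - C q * X - C p * C t * C u * X
      D₃ = 1# - C q * C v * X
      D₄ = 1# - C q * C s * C v * X
      D  = D₁ * D₂ * D₃ * D₄
      D₀ : D 0 R.≈ R.1#
      D₀ = *-one (D₁ * D₂ * D₃) D₄
             (*-one (D₁ * D₂) D₃
               (*-one D₁ D₂ (−X-one 1# (C q * C s) R.refl)
                 (−X-one (1# - C q * X) (C p * C t * C u) (−X-one 1# (C q) R.refl)))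
               (−X-one 1# (C q * C v) R.refl))
             (−X-one 1# (C q * C s * C v) R.refl)

-- Weights of layered permutations

decreasing-max : ∀ n j → lookup (decreasing n) j ≤ lookup (decreasing n) zero
decreasing-max n       zero    = ℕ.≤-refl
decreasing-max (suc n) (suc j) = ℕ.<⇒≤ (from (tail≤first (decreasing n) j) (decreasing-max n j))

-- After `1⊕_` every later letter exceeds the first. A letter above `π₀` is at least `π₀ + 1`, so it
-- stays above the first letter when `π` is enlarged.
multilayered-nonmax : ∀ n →
  ListAll.All (λ π → ∃ λ j → lookup π zero < lookup π j) (multilayered n)
multilayered-nonmax zero    = []
multilayered-nonmax (suc n) = ListAll.++⁺
  (ListAll.map⁺ (ListAll.universal (λ π → suc zero , 0<tail π zero) (layered n)))
  (ListAll.map⁺ (ListAll.map (λ {π} (j , π₀<πⱼ) → suc j , from (h<tail _ π j) π₀<πⱼ)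
                             (multilayered-nonmax n)))

-- Recurrences for the weighted sums

module WeightedSums (R : CommutativeRing c ℓ) where
  open CommutativeRing R hiding (zero)
  open Exp semiring using (_^_)
  open GeneratingFunction R
  open IntegerCoefficientSolver R using (solve; _:=_; con; _:*_; _:+_)
  open RationalIdentity R using (one)
  open SetoidReasoning setoid

  1^ : ∀ n → 1# ^ n ≈ 1#
  1^ zero    = refl
  1^ (suc n) = trans (*-identityˡ _) (1^ n)

  Σ[_] : (T → Carrier) → List T → Carrier
  Σ[ f ] = List.foldr _+_ 0# ∘ List.map f

  Σ-↭ : ∀ (f : T → Carrier) {xs ys} → xs ↭ ys → Σ[ f ] xs ≈ Σ[ f ] ys
  Σ-↭ f xs↭ys = SetoidPermutation.foldr-commMonoid setoid +-isCommutativeMonoid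
    (SetoidPermutation.map⁺ (≡.setoid _) setoid (reflexive ∘ ≡.cong f) (↭⇒↭ₛ xs↭ys))

  Σ-++ : ∀ (f : T → Carrier) xs ys → Σ[ f ] (xs ++ ys) ≈ Σ[ f ] xs + Σ[ f ] ys
  Σ-++ f List.[]       ys = sym (+-identityˡ _)
  Σ-++ f (x List.∷ xs) ys = trans (+-congˡ (Σ-++ f xs ys)) (sym (+-assoc _ _ _))

  Σ-map-scale : ∀ {f : U → Carrier} {g : T → Carrier} {h : T → U} {r xs} →
                ListAll.All (λ x → f (h x) ≈ r * g x) xs → Σ[ f ] (List.map h xs) ≈ r * Σ[ g ] xs
  Σ-map-scale []       = sym (zeroʳ _)
  Σ-map-scale (e ∷ es) = trans (+-cong e (Σ-map-scale es)) (sym (distribˡ _ _ _))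

  module _ (p q u v t : Carrier) where

    W : Carrier → Vec (Fin n) n → Carrier
    W s = weight p q u v s t

    -- As `lrmin` is reset to 1, a single factor `s` remains and `π` must contribute none;
    -- evaluating its weight at `s = 1` achieves this.
    weight-1⊕ : ∀ s (π : Vec (Fin (suc n)) (suc n)) → W s (1⊕ π) ≈ p * u * t * s * W 1# π
    weight-1⊕ s π
      rewrite asc-1⊕ π | des-1⊕ π | lrmax-1⊕ π | rlmax-1⊕ π | lrmin-1⊕ π | rlmin-1⊕ π = begin
      p * pᵃ * qᵈ * (u * uˡ) * vʳ * (s * 1#) * (t * tᵐ)
        ≈⟨ solve 9 (λ p u s t a d l r m →
             p :* a :* d :* (u :* l) :* r :* (s :* one) :* (t :* m)
             := p :* u :* t :* s :* (a :* d :* l :* r :* one :* m)) refl p u s t pᵃ qᵈ uˡ vʳ tᵐ ⟩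
      p * u * t * s * (pᵃ * qᵈ * uˡ * vʳ * 1# * tᵐ)
        ≈⟨ *-congˡ (*-congʳ (*-congˡ (1^ (lrmin π)))) ⟨
      p * u * t * s * W 1# π ∎
      where
      pᵃ = p ^ asc π
      qᵈ = q ^ des π
      uˡ = u ^ lrmax π
      vʳ = v ^ rlmax π
      tᵐ = t ^ rlmin π

    weight-enlarge-max : ∀ s (π : Vec (Fin (suc n)) (suc n)) → (∀ j → lookup π j ≤ lookup π zero) →
                         W s (enlarge π) ≈ q * v * s * W s π
    weight-enlarge-max s π max
      rewrite asc-enlarge π | des-enlarge π | lrmax-enlarge π | rlmax-enlarge-max π max
            | lrmin-enlarge π | rlmin-enlarge π =
      solve 9 (λ q v s a d l r k m →
        a :* (q :* d) :* l :* (v :* r) :* (s :* k) :* m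
        := q :* v :* s :* (a :* d :* l :* r :* k :* m))
        refl q v s (p ^ asc π) (q ^ des π) (u ^ lrmax π) (v ^ rlmax π) (s ^ lrmin π) (t ^ rlmin π)

    weight-enlarge-nonmax : ∀ s (π : Vec (Fin (suc n)) (suc n)) →
                            (∃ λ j → lookup π zero < lookup π j) →
                            W s (enlarge π) ≈ q * s * W s π
    weight-enlarge-nonmax s π nonmax
      rewrite asc-enlarge π | des-enlarge π | lrmax-enlarge π | rlmax-enlarge-nonmax π nonmax
            | lrmin-enlarge π | rlmin-enlarge π =
      solve 8 (λ q s a d l r k m →
        a :* (q :* d) :* l :* r :* (s :* k) :* m := q :* s :* (a :* d :* l :* r :* k :* m))
        refl q s (p ^ asc π) (q ^ des π) (u ^ lrmax π) (v ^ rlmax π) (s ^ lrmin π) (t ^ rlmin π)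

    δ μ : Carrier → ℕ → Carrier
    δ s n = W s (decreasing n)
    μ s n = Σ[ W s ] (multilayered n)

    δ-zero : ∀ s → δ s 0 ≈ u * v * s * t
    δ-zero s = solve 4 (λ u v s t →
      one :* one :* (u :* one) :* (v :* one) :* (s :* one) :* (t :* one)
      := u :* v :* s :* t) refl u v s t

    δ-suc : ∀ s n → δ s (suc n) ≈ q * v * s * δ s n
    δ-suc s n = weight-enlarge-max s (decreasing n) (decreasing-max n)

    μ-suc : ∀ s n → μ s (suc n) ≈ p * u * t * s * (δ 1# n + μ 1# n) + q * s * μ s n
    μ-suc s n = trans (Σ-++ (W s) (List.map 1⊕_ (layered n)) (List.map enlarge (multilayered n)))
      (+-cong (Σ-map-scale {xs = layered n} (ListAll.universal (weight-1⊕ s) (layered n)))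
              (Σ-map-scale (ListAll.map (λ {π} → weight-enlarge-nonmax s π)
                                         (multilayered-nonmax n))))

    F-zero : ∀ s → F ([231] , [312]) p q u v s t 0 ≈ 1#
    -- Only the empty permutation contributes, with all six exponents 0; `con +0` is the end of the
    -- fold.
    F-zero s = solve 0 (one :* one :* one :* one :* one :* one :+ con +0 := one) refl

    F-suc : ∀ s n → F ([231] , [312]) p q u v s t (suc n) ≈ δ s n + μ s n
    F-suc s n = Σ-↭ (W s) (S↭layered n)

theorem7 : ∀ {c ℓ} (R : CommutativeRing c ℓ) (p′ q′ u′ v′ s′ t′ : CommutativeRing.Carrier R) →
    let open PowerSeries R
        x = X
        p = C p′
        q = C q′
        u = C u′
        v = C v′
        s = C s′
        t = C t′
    in GeneratingFunction.F R ([231] , [312]) p′ q′ u′ v′ s′ t′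
       ≈ A R x p q u v s t
         / ((1# - q * s * x) * (1# - q * x - p * t * u * x) * (1# - q * v * x) * (1# - q * s * v * x))
theorem7 R p q u v s t = quotient p q u v t (δ p q u v t) (μ p q u v t)
  (δ-zero p q u v t) (δ-suc p q u v t) (λ _ → refl) (μ-suc p q u v t)
  s (F-zero p q u v t s) (F-suc p q u v t s)
  where
  open LinearRecurrence R
  open WeightedSums R
  open CommutativeRing R using (refl)
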